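{- Let $S[1,n]$ be a sequence over $[1,\sigma]$ with $u$ distinct values, represented by its balanced wavelet tree, and let $S[i_1,j_1],\dots,S[i_k,j_k]$ be $k$ ranges of $S$ (with values in arbitrary order and possibly repeated). Let $\alpha$ be the alternation complexity of the problem of intersecting these $k$ ranges. Then the wavelet tree range intersection algorithm, which computes the distinct values common to all of $S[i_1,j_1],\dots,S[i_k,j_k]$, requires time $\mathcal{O}\left(\alpha k\log\frac{u}{\alpha}\right)$.
   Context: Logarithms are in base 2; inside a complexity, $\log x$ is understood as $\max(1,\log x)$. Time is measured on the word RAM. Wavelet tree. The balanced wavelet tree of $S[1,n]$ is an ordered, strictly binary tree whose leaves are labeled, from left to right, with the distinct symbols of $S$ in increasing order, and such that at each internal node the numbers of leaves in the left and right subtrees differ by at most 1. For a node $v$, let $S_v$ be the subsequence of $S$ formed by the occurrences of the symbols labeling leaves that descend from $v$ (so $S_{root}=S$). Each internal node $v$ stores a bitmap $B_v$ of length $|S_v|$, where $B_v[p]=0$ if the symbol $S_v[p]$ labels a leaf in the left subtree of $v$, and $B_v[p]=1$ otherwise. The bitmaps are stored so that $rank_b(B_v,p)$, the number of bits equal to $b\in\{0,1\}$ in $B_v[1,p]$, is computed in constant time. Algorithm. Start at the root with the $k$ ranges $[i_r,j_r]$, $1\le r\le k$. At a node $v$ with current ranges $[i_r,j_r]$ (positions in $S_v$): if any of the $k$ ranges is empty ($i_r>j_r$), abandon this branch. Otherwise, if $v$ is a leaf, report its label as a member of the intersection (it occurs $j_r-i_r+1$ times in the $r$th range). Otherwise,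 recurse on the left child with the ranges $[rank_0(B_v,i_r-1)+1,\ rank_0(B_v,j_r)]$, and on the right child with the ranges $[rank_1(B_v,i_r-1)+1,\ rank_1(B_v,j_r)]$, $1\le r\le k$. Alternation complexity. Consider functions $C:[1,\sigma]\to[0,k]$ such that $C[c]=0$ if symbol $c$ appears in all the ranges $S[i_1,j_1],\dots,S[i_k,j_k]$, and otherwise $C[c]$ is the index $r\in[1,k]$ of some range $S[i_r,j_r]$ in which $c$ does not appear. The alternation complexity $\alpha$ is the number of zeros in $C$ (the same for all such functions) plus the minimum, over all such functions $C$, of the number of switches, i.e. of the number of $c\in[1,\sigma-1]$ with $C[c]\ne C[c+1]$. The input ranges are nonempty: $1\le i_r\le j_r\le n$ for every $r$. -}

module Defs where

open import Data.Bool using (Bool; true; false; not; if_then_else_)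
import Data.Bool.Properties as Bool
open import Data.Fin using (Fin; zero; suc; inject₁)
import Data.Fin.Properties as Fin
open import Data.List using (List; []; _∷_; _++_; length; filter; map; take; drop; allFin)
open import Data.List.Membership.Propositional using (_∈_; _∉_)
open import Data.List.Relation.Unary.Unique.Propositional using (Unique)
open import Data.Nat using (ℕ; zero; suc; _+_; _*_; _∸_; _^_; _≤_; _<ᵇ_; ∣_-_∣)
open import Data.Product using (∃-syntax; _×_)
open import Data.Sum using (_⊎_)
open import Data.Unit using (⊤; tt)
open import Data.Vec using (Vec; []; _∷_; lookup)
open import Function using (_⇔_)
open import Relation.Binary.PropositionalEquality using (_≡_)
open import Relation.Nullary using (does; ¬?)

module _ {σ : ℕ} where
  open import Data.List.Membership.DecPropositional (Fin._≟_ {σ}) public using (_∈?_)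

private variable
  σ k : ℕ
  A B : Set

------------------------------------------------------------------------
-- Sequences and ranges

-- The alphabet [1,σ] is Fin σ, shifted down by one; positions in sequences
-- and bitmaps are natural numbers counted from 1.

distinct : List (Fin σ) → List (Fin σ)
distinct {σ} S = filter (_∈? S) (allFin σ)

record Range : Set where
  constructor [_,_]
  field
    lo hi : ℕ

open Range public

-- Intended for 1 ≤ lo; the endpoints are inclusive.
slice : List A → Range → List A
slice S [ i , j ] = drop (i ∸ 1) (take j S)

NonemptyRangesOf : List (Fin σ) → Vec Range k → Set
NonemptyRangesOf S R =
  ∀ r → 1 ≤ lo (lookup R r) × lo (lookup R r) ≤ hi (lookup R r) × hi (lookup R r) ≤ length S

InAllRanges : List (Fin σ) → Vec Range k → Fin σ → Set
InAllRanges S R c = ∀ r → c ∈ slice S (lookup R r)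

------------------------------------------------------------------------
-- Balanced wavelet trees

Bitmap : Set
Bitmap = List Bool   -- false is the bit 0, true is the bit 1

rank : Bool → Bitmap → ℕ → ℕ
rank b B p = length (filter (Bool._≟ b) (take p B))

data Tree (σ : ℕ) : Set where
  leaf : Fin σ → Tree σ
  node : Bitmap → Tree σ → Tree σ → Tree σ

leaves : Tree σ → List (Fin σ)
leaves (leaf c)     = c ∷ []
leaves (node _ l r) = leaves l ++ leaves r

-- The sequence S_v.
subsequence : List (Fin σ) → Tree σ → List (Fin σ)
subsequence S v = filter (_∈? leaves v) S

data Balanced {σ : ℕ} : Tree σ → Set where
  leaf : ∀ {c} → Balanced (leaf c)
  node : ∀ {B l r} → ∣ length (leaves l) - length (leaves r) ∣ ≤ 1 →
         Balanced l → Balanced r → Balanced (node B l r)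

data StoresBitmaps {σ : ℕ} (S : List (Fin σ)) : Tree σ → Set where
  leaf : ∀ {c} → StoresBitmaps S (leaf c)
  node : ∀ {B l r} →
         B ≡ map (λ c → not (does (c ∈? leaves l))) (subsequence S (node B l r)) →
         StoresBitmaps S l → StoresBitmaps S r → StoresBitmaps S (node B l r)

-- The tree is not determined by S: when the number of leaves below a node is
-- odd, either child may receive the extra leaf.
record IsBalancedWaveletTree (S : List (Fin σ)) (W : Tree σ) : Set where
  field
    leaves-distinct : leaves W ≡ distinct S
    balanced        : Balanced W
    bitmaps         : StoresBitmaps S W

------------------------------------------------------------------------
-- The intersection algorithm

-- Running times of the constant-time primitives, in word-RAM steps:
-- entering a node or a loop iteration (or leaving a loop), one addition or
-- subtraction, one comparison, one rank query on a stored bitmap, and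
-- reporting one symbol.
record CostModel : Set where
  field
    control arith compare rankQuery report : ℕ

-- A run has a running time, the list of symbols it reports in order, and a
-- result.
record Run (σ : ℕ) (A : Set) : Set where
  constructor mkRun
  field
    time   : ℕ
    output : List (Fin σ)
    result : A

open Run public

module Algorithm (cost : CostModel) {σ : ℕ} where
  open CostModel cost

  return : A → Run σ A
  return x = mkRun 0 [] x

  infixl 1 _>>=_ _>>_

  _>>=_ : Run σ A → (A → Run σ B) → Run σ B
  mkRun t xs x >>= f = let mkRun t′ ys y = f x in mkRun (t + t′) (xs ++ ys) y

  _>>_ : Run σ A → Run σ B → Run σ B
  m >> m′ = m >>= λ _ → m′

  tick : ℕ → Run σ ⊤
  tick t = mkRun t [] tt

  reportSymbol : Fin σ → Run σ ⊤
  reportSymbol c = mkRun report (c ∷ []) tt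

  isEmpty : Range → Run σ Bool
  isEmpty [ i , j ] = do
    tick compare
    return (j <ᵇ i)

  pred : ℕ → Run σ ℕ
  pred i = do
    tick arith
    return (i ∸ 1)

  succ : ℕ → Run σ ℕ
  succ i = do
    tick arith
    return (suc i)

  queryRank : Bool → Bitmap → ℕ → Run σ ℕ
  queryRank b B p = do
    tick rankQuery
    return (rank b B p)

  anyEmpty : Vec Range k → Run σ Bool
  anyEmpty [] = do
    tick control
    return false
  anyEmpty (ρ ∷ R) = do
    tick control
    e ← isEmpty ρ
    if e then return true else anyEmpty R

  -- Map ranges of S_v to ranges of the sequence of the left child
  -- (b = false) or of the right child (b = true), where B is the bitmap of v.
  childRanges : Bool → Bitmap → Vec Range k → Run σ (Vec Range k)
  childRanges b B [] = do
    tick control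
    return []
  childRanges b B ([ i , j ] ∷ R) = do
    tick control
    i⁻ ← pred i
    p  ← queryRank b B i⁻
    i′ ← succ p
    j′ ← queryRank b B j
    R′ ← childRanges b B R
    return ([ i′ , j′ ] ∷ R′)

  intersect : Tree σ → Vec Range k → Run σ ⊤
  descend   : Tree σ → Vec Range k → Run σ ⊤

  intersect v R = do
    tick control
    e ← anyEmpty R
    if e then return tt else descend v R

  descend (leaf c) R = reportSymbol c
  descend (node B l r) R = do
    Rˡ ← childRanges false B R
    intersect l Rˡ
    Rʳ ← childRanges true B R
    intersect r Rʳ

open Algorithm public using (intersect)

ReportsIntersection : List (Fin σ) → Vec Range k → List (Fin σ) → Set
ReportsIntersection S R xs = Unique xs × (∀ c → c ∈ xs ⇔ InAllRanges S R c)

------------------------------------------------------------------------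
-- Alternation complexity

IsCertificate : List (Fin σ) → Vec Range k → (Fin σ → Fin (suc k)) → Set
IsCertificate S R C = ∀ c →
  (InAllRanges S R c × C c ≡ zero) ⊎
  (∃[ r ] c ∉ slice S (lookup R r) × C c ≡ suc r)

zeros : (Fin σ → Fin (suc k)) → ℕ
zeros {σ} C = length (filter (λ c → C c Fin.≟ zero) (allFin σ))

switches : (Fin σ → Fin (suc k)) → ℕ
switches {zero}  C = 0
switches {suc m} C =
  length (filter (λ c → ¬? (C (inject₁ c) Fin.≟ C (suc c))) (allFin m))

IsAlternationComplexity : List (Fin σ) → Vec Range k → ℕ → Set
IsAlternationComplexity S R α =
  ∃[ C ] IsCertificate S R C
       × (∀ C′ → IsCertificate S R C′ → switches C ≤ switches C′)
       × α ≡ zeros C + switches C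

------------------------------------------------------------------------
-- Logarithmic bounds

-- For y > 0, this says t ≤ m · max(1, log₂ (x / y)) with the real logarithm:
-- t ≤ m · log₂ (x / y) means 2 ^ t ≤ (x / y) ^ m, and the denominator is
-- cleared.
infix 4 _≤_·log[_/_]

_≤_·log[_/_] : ℕ → ℕ → ℕ → ℕ → Set
t ≤ m ·log[ x / y ] = t ≤ m ⊎ 2 ^ t * y ^ m ≤ x ^ m

{-# OPTIONS --safe #-}
module Submission where

-- A node at which no range is empty must contain, among its leaves, a zero of C or two
-- neighbouring leaves on which C differs: if C were constantly r ≠ 0 there, the r-th range
-- would be empty at the node.  There are at most α such points and each is contained in one
-- node per level, so a level at depth d has at most min(2ᵈ, α) live nodes.  Summing over the
-- O(log u) levels, with the two bounds separated at depth ⌊log₂ α⌋, gives O(α (1 + log (u/α)))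
-- visited nodes, each of which costs O(k).

open import Defs
open import Data.Bool using (Bool; true; false; not; if_then_else_)
import Data.Bool.Properties as Bool
open import Data.Empty using (⊥-elim)
open import Data.Fin using (Fin; zero; suc; inject₁)
import Data.Fin.Properties as Fin
open import Data.List using (List; []; _∷_; _++_; length; filter; map; take; drop; allFin; tabulate)
open import Data.List.Properties
open import Data.List.Membership.Propositional using (_∈_; _∉_; find; lose)
open import Data.List.Membership.Propositional.Properties
  using (∈-++⁺ˡ; ∈-++⁺ʳ; ∈-++⁻; ∈-filter⁺; ∈-filter⁻; ∈-allFin)
open import Data.List.Relation.Binary.Sublist.Propositional using (_⊆_; []; _∷_; _∷ʳ_)
open import Data.List.Relation.Binary.Sublist.Propositional.Properties using (filter-⊆; filter⁺; map⁺; length-mono-≤)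
open import Data.List.Relation.Unary.All as All using (All; []; _∷_)
open import Data.List.Relation.Unary.AllPairs using ([]; _∷_)
open import Data.List.Relation.Unary.Any as Any using (Any; here; there)
import Data.List.Relation.Unary.All.Properties as All
open import Data.List.Relation.Unary.Unique.Propositional using (Unique)
import Data.List.Relation.Unary.Unique.Propositional.Properties as Unique
open import Data.Nat
  using (ℕ; zero; suc; _+_; _*_; _∸_; _^_; _≤_; _<_; _<ᵇ_; _<?_; z≤n; s≤s; s≤s⁻¹; NonZero; ∣_-_∣; >-nonZero)
open import Data.Nat.Properties
open import Data.Nat.Tactic.RingSolver using (solve-∀)
open import Data.Product using (∃-syntax; _×_; _,_; proj₁; proj₂)
open import Data.Sum using (_⊎_; inj₁; inj₂; [_,_]′)
open import Data.Vec as Vec using (Vec; []; _∷_; lookup)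
open import Data.Vec.Properties using (lookup-map)
open import Function using (_⇔_; mk⇔; _∘_; id; Equivalence)
open import Level using (0ℓ)
open import Relation.Binary.PropositionalEquality hiding ([_])
open import Relation.Nullary using (¬_; yes; no; does; ¬?; contradiction)
open import Relation.Nullary.Decidable using (dec-true; dec-false)
open import Relation.Unary using (Pred; Decidable)

private variable
  σ k n : ℕ
  A : Set

-- Lists and slices

module _ {P Q R : A → Set} (P? : Decidable P) (Q? : Decidable Q) (R? : Decidable R) where

  filter-filter : (∀ x → (P x × Q x) ⇔ R x) → ∀ xs → filter Q? (filter P? xs) ≡ filter R? xs
  filter-filter PQ⇔R [] = refl
  filter-filter PQ⇔R (x ∷ xs) with P? x
  ... | no ¬p = trans (filter-filter PQ⇔R xs)
                  (sym (filter-reject R? (¬p ∘ proj₁ ∘ Equivalence.from (PQ⇔R x))))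
  ... | yes p with Q? x
  ...   | yes q = trans (cong (x ∷_) (filter-filter PQ⇔R xs))
                    (sym (filter-accept R? (Equivalence.to (PQ⇔R x) (p , q))))
  ...   | no ¬q = trans (filter-filter PQ⇔R xs)
                    (sym (filter-reject R? (¬q ∘ proj₂ ∘ Equivalence.from (PQ⇔R x))))

Unique-++⁻ : (xs : List A) {ys : List A} → Unique (xs ++ ys) →
             Unique xs × Unique ys × (∀ {x} → x ∈ xs → x ∉ ys)
Unique-++⁻ []       u       = [] , u , λ ()
Unique-++⁻ (x ∷ xs) (a ∷ u) =
  let uˡ , uʳ , disjoint = Unique-++⁻ xs u in
  All.++⁻ˡ xs a ∷ uˡ , uʳ ,
  λ { (here refl) x∈ys → All.lookup (All.++⁻ʳ xs a) x∈ys refl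
    ; (there x∈xs)     → disjoint x∈xs }

∈-slice⁻ : ∀ {x : A} xs ρ → x ∈ slice xs ρ → x ∈ xs
∈-slice⁻ xs [ i , j ] = take⁻ j xs ∘ drop⁻ (i ∸ 1) (take j xs)
  where
  drop⁻ : ∀ {x : A} n xs → x ∈ drop n xs → x ∈ xs
  drop⁻ zero    xs       x∈ = x∈
  drop⁻ (suc n) (_ ∷ xs) x∈ = there (drop⁻ n xs x∈)

  take⁻ : ∀ {x : A} n xs → x ∈ take n xs → x ∈ xs
  take⁻ (suc n) (_ ∷ xs) (here eq)  = here eq
  take⁻ (suc n) (_ ∷ xs) (there x∈) = there (take⁻ n xs x∈)

slice-nonempty : (xs : List A) {ρ : Range} → 1 ≤ lo ρ → lo ρ ≤ hi ρ → hi ρ ≤ length xs →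
                 ∃[ x ] x ∈ slice xs ρ
slice-nonempty xs {[ suc i , j ]} _ i<j j≤n = go xs i j i<j j≤n
  where
  go : (xs : List A) (i j : ℕ) → i < j → j ≤ length xs → ∃[ x ] x ∈ drop i (take j xs)
  go (x ∷ xs) zero    (suc j) _         _         = x , here refl
  go (x ∷ xs) (suc i) (suc j) (s≤s i<j) (s≤s j≤n) = go xs i j i<j j≤n

slice-empty : (xs : List A) {ρ : Range} → hi ρ < lo ρ → slice xs ρ ≡ []
slice-empty xs {[ suc i , j ]} (s≤s j≤i) =
  drop-all i (take j xs) (≤-trans (≤-reflexive (length-take j xs)) (≤-trans (m⊓n≤m j _) j≤i))

-- Rank queries

childRange : Bool → Bitmap → Range → Range
childRange b B [ i , j ] = [ suc (rank b B (i ∸ 1)) , rank b B j ]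

module _ (f : A → Bool) (b : Bool) where

  private
    keep : List A → List A
    keep = filter (λ x → f x Bool.≟ b)

  rank-map : ∀ xs p → rank b (map f xs) p ≡ length (keep (take p xs))
  rank-map xs       zero    = refl
  rank-map []       (suc p) = refl
  rank-map (x ∷ xs) (suc p) with does (f x Bool.≟ b)
  ... | true  = cong suc (rank-map xs p)
  ... | false = rank-map xs p

  rank≤length : ∀ xs p → rank b (map f xs) p ≤ length (keep xs)
  rank≤length xs       zero    = z≤n
  rank≤length []       (suc p) = z≤n
  rank≤length (x ∷ xs) (suc p) with does (f x Bool.≟ b)
  ... | true  = s≤s (rank≤length xs p)
  ... | false = rank≤length xs p

  take-keep : ∀ xs j → take (length (keep (take j xs))) (keep xs) ≡ keep (take j xs)
  take-keep xs       zero    = refl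
  take-keep []       (suc j) = refl
  take-keep (x ∷ xs) (suc j) with does (f x Bool.≟ b)
  ... | true  = cong (x ∷_) (take-keep xs j)
  ... | false = take-keep xs j

  drop-keep : ∀ xs i j → drop (length (keep (take i xs))) (keep (take j xs)) ≡ keep (drop i (take j xs))
  drop-keep xs       zero    j       = refl
  -- Here `i` lies beyond `j` and both sides are empty, so the identity also covers empty ranges.
  drop-keep xs       (suc i) zero    = drop-[] (length (keep (take (suc i) xs)))
  drop-keep []       (suc i) (suc j) = refl
  drop-keep (x ∷ xs) (suc i) (suc j) with does (f x Bool.≟ b)
  ... | true  = drop-keep xs i j
  ... | false = drop-keep xs i j

  -- Why the two rank queries suffice: `rank` at `i ∸ 1` counts the kept elements before the slice
  -- and `rank` at `j` those up to its end, so cutting `keep xs` at these two counts leaves exactly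
  -- the kept part of the slice.
  slice-childRange : ∀ xs ρ → slice (keep xs) (childRange b (map f xs) ρ) ≡ keep (slice xs ρ)
  slice-childRange xs [ i , j ]
    rewrite rank-map xs (i ∸ 1) | rank-map xs j | take-keep xs j = drop-keep xs (i ∸ 1) j

-- Ranges at a node of a wavelet tree

-- ρ is the range of S_v onto which the algorithm maps a range of S with contents xs.
record Represents (S : List (Fin σ)) (v : Tree σ) (xs : List (Fin σ)) (ρ : Range) : Set where
  field
    lo-positive : 1 ≤ lo ρ
    hi-bounded  : hi ρ ≤ length (subsequence S v)
    contents    : slice (subsequence S v) ρ ≡ filter (_∈? leaves v) xs

  hi<lo⇒misses : hi ρ < lo ρ → ∀ {c} → c ∈ leaves v → c ∉ xs
  hi<lo⇒misses hi<lo {c} c∈v c∈xs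
    with () ← subst (c ∈_) (trans (sym contents) (slice-empty (subsequence S v) hi<lo))
                (∈-filter⁺ (_∈? leaves v) c∈xs c∈v)

  -- The fields `lo-positive` and `hi-bounded` serve this direction: with them, `lo ≤ hi` guarantees
  -- a real position of the subsequence inside the range. Together with `hi<lo⇒misses`, the test on
  -- endpoints decides whether the original range contains a symbol below `v`.
  lo≤hi⇒meets : lo ρ ≤ hi ρ → ∃[ c ] c ∈ leaves v × c ∈ xs
  lo≤hi⇒meets lo≤hi =
    let c , c∈slice = slice-nonempty (subsequence S v) lo-positive lo≤hi hi-bounded
        c∈xs , c∈v  = ∈-filter⁻ (_∈? leaves v) (subst (c ∈_) contents c∈slice)
    in c , c∈v , c∈xs

open Represents

child : Bool → Tree σ → Tree σ → Tree σ
child false l r = l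
child true  l r = r

module _ {S : List (Fin σ)} {l r : Tree σ} where

  private
    bit : Fin σ → Bool
    bit c = not (does (c ∈? leaves l))

  -- The bit records only membership in the left subtree. A 1 means "right" because the symbol is
  -- known to lie below the node; conversely, disjointness prevents a symbol on the right from
  -- having bit 0.
  ∈-child : (∀ {c} → c ∈ leaves l → c ∉ leaves r) → ∀ b c →
            (c ∈ leaves l ++ leaves r × bit c ≡ b) ⇔ c ∈ leaves (child b l r)
  ∈-child disjoint b c with c ∈? leaves l
  ∈-child disjoint false c | yes c∈l = mk⇔ (λ _ → c∈l) (λ _ → ∈-++⁺ˡ c∈l , refl)
  ∈-child disjoint true  c | yes c∈l = mk⇔ (λ ()) (λ c∈r → ⊥-elim (disjoint c∈l c∈r))
  ∈-child disjoint false c | no  c∉l = mk⇔ (λ ()) (λ c∈l → ⊥-elim (c∉l c∈l))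
  ∈-child disjoint true  c | no  c∉l =
    mk⇔ (λ (c∈v , _) → [ ⊥-elim ∘ c∉l , id ]′ (∈-++⁻ (leaves l) c∈v))
        (λ c∈r → ∈-++⁺ʳ (leaves l) c∈r , refl)

  -- Selecting by bit turns the subsequence of `v` into that of the child, and the part of `xs`
  -- below `v` into the part below the child; by `slice-childRange` this selection commutes with
  -- slicing.
  represents-child : ∀ {B} → (∀ {c} → c ∈ leaves l → c ∉ leaves r) →
    B ≡ map bit (subsequence S (node B l r)) → ∀ b {xs ρ} →
    Represents S (node B l r) xs ρ → Represents S (child b l r) xs (childRange b B ρ)
  represents-child {B} disjoint B≡ b {xs} {ρ} rep = record
    { lo-positive = s≤s z≤n
    ; hi-bounded  = hi-bound
    ; contents    = begin
        slice (subsequence S w) (childRange b B ρ)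
          ≡⟨ cong₂ slice (sym (restrict S)) (cong (λ B → childRange b B ρ) B≡) ⟩
        slice (filter bit≟b Sᵥ) (childRange b (map bit Sᵥ) ρ)
          ≡⟨ slice-childRange bit b Sᵥ ρ ⟩
        filter bit≟b (slice Sᵥ ρ)
          ≡⟨ cong (filter bit≟b) (contents rep) ⟩
        filter bit≟b (filter (_∈? leaves v) xs)
          ≡⟨ restrict xs ⟩
        filter (_∈? leaves w) xs ∎
    }
    where
    open ≡-Reasoning
    v = node B l r
    w = child b l r
    Sᵥ = subsequence S v
    bit≟b = λ c → bit c Bool.≟ b

    restrict : ∀ xs → filter bit≟b (filter (_∈? leaves v) xs) ≡ filter (_∈? leaves w) xs
    restrict = filter-filter (_∈? leaves v) bit≟b (_∈? leaves w) (∈-child disjoint b)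

    hi-bound : rank b B (hi ρ) ≤ length (subsequence S w)
    hi-bound = subst₂ _≤_ (cong (λ B → rank b B (hi ρ)) (sym B≡)) (cong length (restrict S))
                 (rank≤length bit b Sᵥ (hi ρ))

-- Alternations

change : Fin n → Fin n → ℕ
change x y = if does (x Fin.≟ y) then 0 else 1

change-triangle : (x y z : Fin n) → change x z ≤ change x y + change y z
change-triangle x y z with x Fin.≟ y | y Fin.≟ z | x Fin.≟ z
... | yes refl | yes refl | yes _  = z≤n
... | yes refl | yes refl | no x≢x = contradiction refl x≢x
... | yes refl | no _     | yes _  = z≤n
... | yes refl | no _     | no _   = ≤-refl
... | no _     | _        | yes _  = z≤n
... | no _     | _        | no _   = s≤s z≤n

alternations : List (Fin n) → ℕ
alternations []           = 0
alternations (x ∷ [])     = 0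
alternations (x ∷ y ∷ xs) = change x y + alternations (y ∷ xs)

alternations-∷ : ∀ (x : Fin n) xs → alternations xs ≤ alternations (x ∷ xs)
alternations-∷ x []       = z≤n
alternations-∷ x (y ∷ xs) = m≤n+m _ (change x y)

-- `change` is the discrete metric, so by its triangle inequality a shortcut past `y` creates no
-- alternation. This is what makes `alternations` monotone under deletion of elements.
alternations-skip : ∀ (x y : Fin n) xs → alternations (x ∷ xs) ≤ alternations (x ∷ y ∷ xs)
alternations-skip x y []       = z≤n
alternations-skip x y (z ∷ xs) = begin
  change x z + alternations (z ∷ xs)                ≤⟨ +-monoˡ-≤ _ (change-triangle x y z) ⟩
  (change x y + change y z) + alternations (z ∷ xs) ≡⟨ +-assoc (change x y) _ _ ⟩
  change x y + (change y z + alternations (z ∷ xs)) ∎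
  where open ≤-Reasoning

alternations-mono-∷ : ∀ (x : Fin n) {xs ys} → xs ⊆ ys → alternations (x ∷ xs) ≤ alternations (x ∷ ys)
alternations-mono-∷ x []          = z≤n
alternations-mono-∷ x {ys = _ ∷ ys} (y ∷ʳ sub) = ≤-trans (alternations-mono-∷ x sub) (alternations-skip x y ys)
alternations-mono-∷ x (refl ∷ sub) = +-monoʳ-≤ (change x _) (alternations-mono-∷ _ sub)

alternations-mono : {xs ys : List (Fin n)} → xs ⊆ ys → alternations xs ≤ alternations ys
alternations-mono []           = z≤n
alternations-mono {ys = _ ∷ ys} (y ∷ʳ sub) = ≤-trans (alternations-mono sub) (alternations-∷ y ys)
alternations-mono (refl ∷ sub) = alternations-mono-∷ _ sub

-- Only an inequality: a change at the junction of the two lists belongs to neither of them.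
alternations-++ : ∀ (xs ys : List (Fin n)) →
                  alternations xs + alternations ys ≤ alternations (xs ++ ys)
alternations-++ []            ys = ≤-refl
alternations-++ (x ∷ [])      ys = alternations-∷ x ys
alternations-++ (x ∷ x′ ∷ xs) ys = begin
  (change x x′ + alternations (x′ ∷ xs)) + alternations ys ≡⟨ +-assoc (change x x′) _ _ ⟩
  change x x′ + (alternations (x′ ∷ xs) + alternations ys) ≤⟨ +-monoʳ-≤ (change x x′) (alternations-++ (x′ ∷ xs) ys) ⟩
  change x x′ + alternations (x′ ∷ xs ++ ys)               ∎
  where open ≤-Reasoning

alternations≡0⇒constant : ∀ (x : Fin n) xs → alternations (x ∷ xs) ≡ 0 → All (_≡ x) (x ∷ xs)
alternations≡0⇒constant x []       _  = refl ∷ []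
alternations≡0⇒constant x (y ∷ xs) eq with x Fin.≟ y
... | yes refl = refl ∷ alternations≡0⇒constant x xs eq

length-filter-map : ∀ {A B : Set} {P : Pred B 0ℓ} (P? : Decidable P) (f : A → B) xs →
                    length (filter P? (map f xs)) ≡ length (filter (P? ∘ f) xs)
length-filter-map P? f [] = refl
length-filter-map P? f (x ∷ xs) with does (P? (f x))
... | true  = cong suc (length-filter-map P? f xs)
... | false = length-filter-map P? f xs

-- Moves from pairs indexed by `inject₁` and `suc` to a recursion on lists, which can be restricted
-- to sublists and split at a concatenation.
switches≡alternations : (C : Fin σ → Fin (suc k)) → switches C ≡ alternations (map C (allFin σ))
switches≡alternations {zero}        C = refl
switches≡alternations {suc zero}    C = refl
switches≡alternations {suc (suc m)} C = trans peel
  (cong (change (C zero) (C (suc zero)) +_) (begin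
    length (filter switch? (tabulate suc))
      ≡⟨ cong (length ∘ filter switch?) (map-tabulate id suc) ⟨
    length (filter switch? (map suc (allFin m)))
      ≡⟨ length-filter-map switch? suc (allFin m) ⟩
    switches (C ∘ suc)
      ≡⟨ switches≡alternations (C ∘ suc) ⟩
    alternations (map (C ∘ suc) (allFin (suc m)))
      ≡⟨ cong alternations (trans (map-∘ (allFin (suc m))) (cong (map C) (map-tabulate id suc))) ⟩
    alternations (map C (tabulate suc)) ∎))
  where
  open ≡-Reasoning
  switch? = λ c → ¬? (C (inject₁ c) Fin.≟ C (suc c))

  peel : switches C ≡
         change (C zero) (C (suc zero)) + length (filter switch? (tabulate suc))
  peel with does (C zero Fin.≟ C (suc zero))
  ... | true  = refl
  ... | false = refl

-- The alternation complexity localized to the symbols below one node: the zeros and the switches of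
-- `C` seen there.
weight : (Fin σ → Fin (suc k)) → List (Fin σ) → ℕ
weight C cs = length (filter (λ c → C c Fin.≟ zero) cs) + alternations (map C cs)

module _ (C : Fin σ → Fin (suc k)) where

  -- The budget inequality: siblings share the weight of their parent, so the weights on one level
  -- of the tree never sum to more than the weight of the root.
  weight-++ : ∀ cs ds → weight C cs + weight C ds ≤ weight C (cs ++ ds)
  weight-++ cs ds = begin
    (z cs + a cs) + (z ds + a ds) ≡⟨ interchange (z cs) (a cs) (z ds) (a ds) ⟩
    (z cs + z ds) + (a cs + a ds) ≤⟨ +-mono-≤ (≤-reflexive z-++) a-++ ⟩
    z (cs ++ ds) + a (cs ++ ds)   ∎
    where
    open ≤-Reasoning
    z a : List (Fin _) → ℕ
    z cs = length (filter (λ c → C c Fin.≟ zero) cs)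
    a cs = alternations (map C cs)

    interchange : ∀ p q r s → (p + q) + (r + s) ≡ (p + r) + (q + s)
    interchange = solve-∀

    z-++ : z cs + z ds ≡ z (cs ++ ds)
    z-++ = sym (trans (cong length (filter-++ _ cs ds)) (length-++ (filter _ cs)))

    a-++ : a cs + a ds ≤ a (cs ++ ds)
    a-++ = ≤-trans (alternations-++ (map C cs) (map C ds))
             (≤-reflexive (cong alternations (sym (map-++ C cs ds))))

  weight-mono : ∀ {cs ds} → cs ⊆ ds → weight C cs ≤ weight C ds
  weight-mono sub =
    +-mono-≤ (length-mono-≤ (filter⁺ _ _ (λ { refl z → z }) sub)) (alternations-mono (map⁺ C sub))

  weight-allFin : weight C (allFin σ) ≡ zeros C + switches C
  weight-allFin = cong (zeros C +_) (sym (switches≡alternations C))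

  weight≡0⇒constant : ∀ c cs → weight C (c ∷ cs) ≡ 0 →
                      ∃[ r ] All (λ d → C d ≡ suc r) (c ∷ cs)
  weight≡0⇒constant c cs w≡0 with C c in eq
  ... | zero  = contradiction w≡0 λ ()
  ... | suc r = r , eq ∷ All.map⁻ (All.tail
    (alternations≡0⇒constant (suc r) (map C cs) (m+n≡0⇒n≡0 (zeros-in cs) w≡0)))
    where zeros-in = λ cs → length (filter (λ d → C d Fin.≟ zero) cs)

-- Leaf counts in balanced trees.

leaves-nonempty : (v : Tree σ) → 1 ≤ length (leaves v)
leaves-nonempty (leaf c)     = ≤-refl
leaves-nonempty (node B l r) = ≤-trans (leaves-nonempty l)
  (≤-trans (m≤m+n _ (length (leaves r))) (≤-reflexive (sym (length-++ (leaves l)))))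

-- If one part exceeded `2 ^ h`, the other would be at least `2 ^ h`, as they differ by at most 1,
-- and the sum would exceed `2 ^ suc h`. Hence a balanced tree with at most `2 ^ h` leaves has
-- height at most `h`.
halves-≤ : ∀ m n h → ∣ m - n ∣ ≤ 1 → m + n ≤ 2 ^ suc h → m ≤ 2 ^ h × n ≤ 2 ^ h
halves-≤ m n h near sum =
  half m n near sum ,
  half n m (subst (_≤ 1) (∣-∣-comm m n) near) (subst (_≤ 2 ^ suc h) (+-comm m n) sum)
  where
  half : ∀ m n → ∣ m - n ∣ ≤ 1 → m + n ≤ 2 ^ suc h → m ≤ 2 ^ h
  half m n near sum = ≮⇒≥ λ 2^h<m → <⇒≱
    (begin-strict
      2 ^ suc h       ≡⟨ cong (2 ^ h +_) (+-identityʳ (2 ^ h)) ⟩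
      2 ^ h + 2 ^ h   <⟨ +-mono-<-≤ 2^h<m (s≤s⁻¹ (≤-trans 2^h<m (m≤1+n m n near))) ⟩
      m + n           ∎) sum
    where
    open ≤-Reasoning
    m≤1+n : ∀ m n → ∣ m - n ∣ ≤ 1 → m ≤ suc n
    m≤1+n m n near = ≤-trans (m≤∣m-n∣+n m n) (+-monoˡ-≤ n near)

-- Visited nodes

module _ {σ k : ℕ} (X : Fin k → List (Fin σ)) where

  Common : Fin σ → Set
  Common c = ∀ r → c ∈ X r

  common? : Decidable Common
  common? c = Fin.all? λ r → c ∈? X r

  -- Phrased through the contents of the input ranges, so that visits can be counted without
  -- following the mapped ranges. At a node reached by the algorithm it agrees with the outcome of
  -- `anyEmpty`, by `live⇒anyEmpty-false` and `¬live⇒anyEmpty-true`.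
  Live : Tree σ → Set
  Live v = ∀ r → Any (_∈ X r) (leaves v)

  live? : Decidable Live
  live? v = Fin.all? λ r → Any.any? (_∈? X r) (leaves v)

  -- The number of nodes that the algorithm enters, abandoned ones included.
  visits : Tree σ → ℕ
  visits (leaf c)         = 1
  visits v@(node _ l r) = suc (if does (live? v) then visits l + visits r else 0)

  visits-¬live : ∀ v → ¬ Live v → visits v ≡ 1
  visits-¬live (leaf c)       _     = refl
  visits-¬live v@(node B l r) ¬live =
    cong (λ b → suc (if b then visits l + visits r else 0)) (dec-false (live? v) ¬live)

  visits-live : ∀ B l r → Live (node B l r) → visits (node B l r) ≡ suc (visits l + visits r)
  visits-live B l r live =
    cong (λ b → suc (if b then visits l + visits r else 0)) (dec-true (live? (node B l r)) live)

  ¬live⇒no-common : ∀ v → ¬ Live v → filter common? (leaves v) ≡ []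
  ¬live⇒no-common v ¬live = filter-none common?
    (All.tabulate λ c∈v common → ¬live λ r → Any.map (λ { refl → common r }) c∈v)

  module _ {C : Fin σ → Fin (suc k)}
           (certificate : ∀ c → (Common c × C c ≡ zero) ⊎ (∃[ r ] c ∉ X r × C c ≡ suc r)) where

    live⇒weight≥1 : ∀ v → Live v → 1 ≤ weight C (leaves v)
    live⇒weight≥1 v live = n≢0⇒n>0 (go (leaves v) (leaves-nonempty v) live)
      where
      go : ∀ cs → 1 ≤ length cs → (∀ r → Any (_∈ X r) cs) → weight C cs ≢ 0
      go (c ∷ cs) _ meets w≡0 =
        let r , constant  = weight≡0⇒constant C c cs w≡0
            d , d∈cs , d∈X = find (meets r)
        in misses r d (All.lookup constant d∈cs) d∈X
        where
        misses : ∀ r d → C d ≡ suc r → d ∉ X r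
        misses r d Cd≡r with certificate d
        ... | inj₁ (_ , Cd≡0) = contradiction (trans (sym Cd≡r) Cd≡0) λ ()
        ... | inj₂ (r′ , d∉X , Cd≡r′) with refl ← trans (sym Cd≡r) Cd≡r′ = d∉X

    -- Above depth D there are at most 2 ^ D nodes; from there down, every level has at most
    -- one live node around each point counted by the weight.
    visits-bound : ∀ v D h → Balanced v → length (leaves v) ≤ 2 ^ h →
      suc (visits v) ≤ 2 * 2 ^ D + 2 * (weight C (leaves v) * (suc h ∸ D))
    visits-bound v D h balanced small = go v D h balanced small
      where
      open ≤-Reasoning

      -- With `L` live internal nodes, `visits` plus one equals `2 + 2 * L`. At most `2 ^ D - 1` of
      -- them lie above depth `D`, and each of the `suc h ∸ D` levels from `D` to `h` has at most
      -- `w`, which gives this expression. The extra one also makes the quantity additive over the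
      -- two children of a live node.
      Bound : ℕ → ℕ → ℕ → ℕ
      Bound D w h = 2 * 2 ^ D + 2 * (w * (suc h ∸ D))

      2≤Bound : ∀ D w h → 2 ≤ Bound D w h
      2≤Bound D w h = ≤-trans (*-monoʳ-≤ 2 (m^n>0 2 D)) (m≤m+n (2 * 2 ^ D) _)

      step : ∀ D h {wl wr w} → wl + wr ≤ w → 1 ≤ w →
             Bound (D ∸ 1) wl h + Bound (D ∸ 1) wr h ≤ Bound D w (suc h)
      -- Past the threshold `D` stays 0. The two children bring two constants where only one is
      -- allowed; the surplus 2 is paid by one more level of weight at least 1.
      step zero h {wl} {wr} {w} sum 1≤w = begin
        Bound 0 wl h + Bound 0 wr h             ≡⟨ regroup wl wr h ⟩
        2 + (2 * 1 + 2 * ((wl + wr) * suc h))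
          ≤⟨ +-mono-≤ {2} (*-monoʳ-≤ 2 1≤w) (+-monoʳ-≤ 2 (*-monoʳ-≤ 2 (*-monoˡ-≤ (suc h) sum))) ⟩
        2 * w + (2 * 1 + 2 * (w * suc h))       ≡⟨ regroup′ w h ⟩
        Bound 0 w (suc h)                       ∎
        where
        regroup : ∀ wl wr h → (2 * 1 + 2 * (wl * suc h)) + (2 * 1 + 2 * (wr * suc h)) ≡
                              2 + (2 * 1 + 2 * ((wl + wr) * suc h))
        regroup = solve-∀
        regroup′ : ∀ w h → 2 * w + (2 * 1 + 2 * (w * suc h)) ≡ 2 * 1 + 2 * (w * suc (suc h))
        regroup′ = solve-∀
      -- Above the threshold the two power terms add up to the next power, and the number of counted
      -- levels is unchanged because both `h` and `D` drop by one.
      step (suc D) h {wl} {wr} {w} sum _ = begin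
        Bound D wl h + Bound D wr h                      ≡⟨ regroup (2 ^ D) wl wr (suc h ∸ D) ⟩
        2 * 2 ^ suc D + 2 * ((wl + wr) * (suc h ∸ D))
          ≤⟨ +-monoʳ-≤ (2 * 2 ^ suc D) (*-monoʳ-≤ 2 (*-monoˡ-≤ (suc h ∸ D) sum)) ⟩
        Bound (suc D) w (suc h)                          ∎
        where
        regroup : ∀ p wl wr d → (2 * p + 2 * (wl * d)) + (2 * p + 2 * (wr * d)) ≡
                                2 * (2 * p) + 2 * ((wl + wr) * d)
        regroup = solve-∀

      go : ∀ v D h → Balanced v → length (leaves v) ≤ 2 ^ h →
           suc (visits v) ≤ Bound D (weight C (leaves v)) h
      go (leaf c) D h _ _ = 2≤Bound D (weight C (c ∷ [])) h
      go (node B l r) D zero _ small = contradiction small (<⇒≱ (begin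
        2                                       ≤⟨ +-mono-≤ (leaves-nonempty l) (leaves-nonempty r) ⟩
        length (leaves l) + length (leaves r)   ≡⟨ length-++ (leaves l) ⟨
        length (leaves l ++ leaves r)           ∎))
      go v@(node B l r) D (suc h) (node near bl br) small with live? v
      ... | no ¬live = ≤-trans (≤-reflexive (cong suc (visits-¬live v ¬live)))
                         (2≤Bound D (weight C (leaves v)) (suc h))
      ... | yes live =
        let smallˡ , smallʳ = halves-≤ (length (leaves l)) (length (leaves r)) h near
                                (subst (_≤ 2 ^ suc h) (length-++ (leaves l)) small)
        in begin
        suc (visits v)                     ≡⟨ cong suc (visits-live B l r live) ⟩
        2 + (visits l + visits r)          ≡⟨ cong suc (+-suc (visits l) (visits r)) ⟨
        suc (visits l) + suc (visits r)    ≤⟨ +-mono-≤ (go l (D ∸ 1) h bl smallˡ) (go r (D ∸ 1) h br smallʳ) ⟩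
        Bound (D ∸ 1) (weight C (leaves l)) h + Bound (D ∸ 1) (weight C (leaves r)) h
          ≤⟨ step D h {weight C (leaves l)} {weight C (leaves r)} (weight-++ C (leaves l) (leaves r)) (live⇒weight≥1 v live) ⟩
        Bound D (weight C (leaves v)) (suc h) ∎

-- Correctness and cost of the algorithm

module Analysis (cost : CostModel) where
  open CostModel cost
  open Algorithm cost using (anyEmpty; childRanges)

  -- Worst-case charges; the leading `control` of a loop pays for leaving it. `visitCost` includes a
  -- report and both mappings, so that one charge covers abandoned nodes, leaves and internal nodes
  -- alike.
  scanCost mapCost visitCost : ℕ → ℕ
  scanCost  k = control + k * (control + compare)
  mapCost   k = control + k * (control + (arith + (rankQuery + (arith + rankQuery))))
  visitCost k = control + (scanCost k + (report + (mapCost k + mapCost k)))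

  -- The part of the charge that does not depend on `k` is multiplied by `k ≥ 1` as well; the slack
  -- is `k - 1` copies of it.
  visitCost-linear : ∀ k .{{_ : NonZero k}} → visitCost k ≤ k * visitCost 1
  visitCost-linear (suc k) = ≤-trans (m≤m+n (visitCost (suc k)) _)
    (≤-reflexive (regroup k control (control + compare) report
      (control + (arith + (rankQuery + (arith + rankQuery))))))
    where
    regroup : ∀ k a s p m →
      a + (a + suc k * s + (p + (a + suc k * m + (a + suc k * m)))) + k * (a + (a + (p + (a + a)))) ≡
      suc k * (a + (a + 1 * s + (p + (a + 1 * m + (a + 1 * m)))))
    regroup = solve-∀

  module _ {σ : ℕ} where

    anyEmpty-output : (R : Vec Range k) → output (anyEmpty {σ} R) ≡ []
    anyEmpty-output [] = refl
    anyEmpty-output (ρ ∷ R) with hi ρ <ᵇ lo ρ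
    ... | true  = refl
    ... | false = anyEmpty-output R

    anyEmpty-time : (R : Vec Range k) → time (anyEmpty {σ} R) ≤ scanCost k
    anyEmpty-time []      = ≤-refl
    anyEmpty-time {suc k} (ρ ∷ R) with hi ρ <ᵇ lo ρ
    ... | true  = ≤-trans (m≤m+n _ (scanCost k))
                    (≤-reflexive (regroup control compare (k * (control + compare))))
      where regroup : ∀ a b p → a + (b + 0 + 0) + (a + p) ≡ a + (a + b + p)
            regroup = solve-∀
    ... | false = ≤-trans (+-monoʳ-≤ control (+-monoʳ-≤ (compare + 0) (anyEmpty-time R)))
                    (≤-reflexive (regroup control compare (k * (control + compare))))
      where regroup : ∀ a b p → a + (b + 0 + (a + p)) ≡ a + (a + b + p)
            regroup = solve-∀

    anyEmpty-true : (R : Vec Range k) → result (anyEmpty {σ} R) ≡ true →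
                    ∃[ r ] hi (lookup R r) < lo (lookup R r)
    anyEmpty-true (ρ ∷ R) eq with hi ρ <ᵇ lo ρ in empty
    ... | true  = zero , <ᵇ⇒< (hi ρ) (lo ρ) (Equivalence.from Bool.T-≡ empty)
    ... | false = let r , hi<lo = anyEmpty-true R eq in suc r , hi<lo

    anyEmpty-false : (R : Vec Range k) → result (anyEmpty {σ} R) ≡ false →
                     ∀ r → lo (lookup R r) ≤ hi (lookup R r)
    anyEmpty-false (ρ ∷ R) eq with hi ρ <ᵇ lo ρ in empty
    anyEmpty-false (ρ ∷ R) eq | false = λ where
      zero    → ≮⇒≥ λ hi<lo →
        contradiction (trans (sym empty) (Equivalence.to Bool.T-≡ (<⇒<ᵇ hi<lo))) λ ()
      (suc r) → anyEmpty-false R eq r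

    childRanges-result : ∀ b B (R : Vec Range k) →
                         result (childRanges {σ} b B R) ≡ Vec.map (childRange b B) R
    childRanges-result b B []      = refl
    childRanges-result b B (ρ ∷ R) = cong (childRange b B ρ ∷_) (childRanges-result b B R)

    childRanges-output : ∀ b B (R : Vec Range k) → output (childRanges {σ} b B R) ≡ []
    childRanges-output b B []      = refl
    childRanges-output b B (ρ ∷ R)
      rewrite childRanges-output b B R = refl

    childRanges-time : ∀ b B (R : Vec Range k) → time (childRanges {σ} b B R) ≡ mapCost k
    childRanges-time b B [] = refl
    childRanges-time {suc k} b B (ρ ∷ R) rewrite childRanges-time b B R =
      regroup control arith rankQuery (k * (control + (arith + (rankQuery + (arith + rankQuery)))))
      where regroup : ∀ c a q p →
                      c + (a + 0 + (q + 0 + (a + 0 + (q + 0 + (c + p + 0))))) ≡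
                      c + (c + (a + (q + (a + q))) + p)
            regroup = solve-∀

  module _ {S : List (Fin σ)} {X : Fin k → List (Fin σ)} where

    AllRepresent : Tree σ → Vec Range k → Set
    AllRepresent v R = ∀ r → Represents S v (X r) (lookup R r)

    live⇒anyEmpty-false : ∀ v R → AllRepresent v R → Live X v → result (anyEmpty {σ} R) ≡ false
    live⇒anyEmpty-false v R rep live = Bool.¬-not λ eq →
      let r , hi<lo = anyEmpty-true R eq
          c , c∈v , c∈X = find (live r)
      in hi<lo⇒misses (rep r) hi<lo c∈v c∈X

    ¬live⇒anyEmpty-true : ∀ v R → AllRepresent v R → ¬ Live X v → result (anyEmpty {σ} R) ≡ true
    ¬live⇒anyEmpty-true v R rep ¬live = Bool.¬-not λ eq → ¬live λ r →
      let c , c∈v , c∈X = lo≤hi⇒meets (rep r) (anyEmpty-false R eq r) in lose c∈v c∈X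

    allRepresent-child : ∀ {B l r R} → Unique (leaves (node B l r)) →
      B ≡ map (λ c → not (does (c ∈? leaves l))) (subsequence S (node B l r)) →
      AllRepresent (node B l r) R →
      ∀ b → AllRepresent (child b l r) (result (childRanges {σ} b B R))
    allRepresent-child {B} {l} {r} {R} unique B≡ rep b i =
      subst (Represents S (child b l r) (X i))
        (sym (trans (cong (λ R → lookup R i) (childRanges-result b B R))
          (lookup-map i (childRange b B) R)))
        (represents-child (proj₂ (proj₂ (Unique-++⁻ (leaves l) unique))) B≡ b (rep i))

    -- Output and time go through one induction on the tree, since liveness decides in both which
    -- branch runs. `AllRepresent` is the invariant handed down to the children.
    intersect-correct : ∀ v R → Unique (leaves v) → StoresBitmaps S v → AllRepresent v R →
      output (intersect cost v R) ≡ filter (common? X) (leaves v) ×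
      time (intersect cost v R) ≤ visitCost k * visits X v
    intersect-correct v R unique bitmaps rep
      with live? X v
    ... | no ¬live
      rewrite ¬live⇒anyEmpty-true v R rep ¬live | anyEmpty-output {σ} R | visits-¬live X v ¬live =
      sym (¬live⇒no-common X v ¬live) , (begin
        control + (time (anyEmpty R) + 0)   ≡⟨ cong (control +_) (+-identityʳ _) ⟩
        control + time (anyEmpty {σ} R)     ≤⟨ +-monoʳ-≤ control (anyEmpty-time R) ⟩
        control + scanCost k                ≤⟨ +-monoʳ-≤ control (m≤m+n (scanCost k) _) ⟩
        visitCost k                         ≡⟨ *-identityʳ _ ⟨
        visitCost k * 1                     ∎)
      where open ≤-Reasoning
    intersect-correct (leaf c) R unique bitmaps rep | yes live
      rewrite live⇒anyEmpty-false (leaf c) R rep live | anyEmpty-output {σ} R =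
      -- At a leaf, meeting every range means that the only label lies in every range.
      sym (filter-all (common? X) ((λ r → Any-singleton⁻ (live r)) ∷ [])) , (begin
        control + (time (anyEmpty {σ} R) + report)  ≤⟨ +-monoʳ-≤ control (+-mono-≤ (anyEmpty-time R) (m≤m+n report _)) ⟩
        visitCost k                                 ≡⟨ *-identityʳ _ ⟨
        visitCost k * 1                             ∎)
      where open ≤-Reasoning
            Any-singleton⁻ : ∀ {P : Pred (Fin σ) 0ℓ} {x} → Any P (x ∷ []) → P x
            Any-singleton⁻ (here p) = p
    intersect-correct v@(node B l r) R unique (node B≡ bl br) rep | yes live
      with uniqueˡ , uniqueʳ , _ ← Unique-++⁻ (leaves l) unique
      with intersect-correct l (result (childRanges {σ} false B R)) uniqueˡ bl
             (allRepresent-child {R = R} unique B≡ rep false)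
         | intersect-correct r (result (childRanges {σ} true B R)) uniqueʳ br
             (allRepresent-child {R = R} unique B≡ rep true)
    ... | outˡ , timeˡ | outʳ , timeʳ
      rewrite live⇒anyEmpty-false v R rep live | anyEmpty-output {σ} R
            | childRanges-output {σ} false B R | childRanges-output {σ} true B R
            | childRanges-time {σ} false B R | childRanges-time {σ} true B R
            | visits-live X B l r live =
      trans (cong₂ _++_ outˡ outʳ) (sym (filter-++ (common? X) (leaves l) (leaves r))) , (begin
        control + (time (anyEmpty {σ} R) + (m + (tˡ + (m + tʳ))))
          ≤⟨ +-monoʳ-≤ control (+-mono-≤ (anyEmpty-time R)
               (≤-trans (+-monoʳ-≤ m (+-mono-≤ timeˡ (+-monoʳ-≤ m timeʳ))) (m≤n+m _ report))) ⟩
        control + (scanCost k + (report + (m + (visitCost k * visits X l + (m + visitCost k * visits X r)))))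
          ≡⟨ regroup control (scanCost k) report m (visits X l) (visits X r) ⟩
        visitCost k * suc (visits X l + visits X r) ∎)
      where
      open ≤-Reasoning
      m = mapCost k
      tˡ = time (intersect cost l (result (childRanges false B R)))
      tʳ = time (intersect cost r (result (childRanges true B R)))
      regroup : ∀ c s p m x y →
        c + (s + (p + (m + ((c + (s + (p + (m + m)))) * x + (m + (c + (s + (p + (m + m)))) * y))))) ≡
        (c + (s + (p + (m + m)))) * suc (x + y)
      regroup = solve-∀

-- The running time

log₂-bracket : ∀ n .{{_ : NonZero n}} → ∃[ D ] 2 ^ D ≤ n × n < 2 ^ suc D
log₂-bracket (suc zero)    = 0 , ≤-refl , ≤-refl
log₂-bracket (suc (suc n)) with log₂-bracket (suc n)
... | D , 2^D≤n , n<2^1+D with suc (suc n) <? 2 ^ suc D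
...   | yes n<2^1+D′ = D , m≤n⇒m≤1+n 2^D≤n , n<2^1+D′
...   | no  n≮2^1+D  = suc D , ≮⇒≥ n≮2^1+D , ≤-<-trans n<2^1+D (^-monoʳ-< 2 ≤-refl (n<1+n (suc D)))

^-distribʳ-* : ∀ n x y → (x * y) ^ n ≡ x ^ n * y ^ n
^-distribʳ-* zero    x y = refl
^-distribʳ-* (suc n) x y =
  trans (cong (x * y *_) (^-distribʳ-* n x y)) (interchange x y (x ^ n) (y ^ n))
  where
  interchange : ∀ a b c d → a * b * (c * d) ≡ a * c * (b * d)
  interchange = solve-∀

-- `f` is a lower estimate of the logarithm; raising `2 ^ f * α ≤ u` to the power `m` gives the form
-- with cleared denominator.
≤-·log : ∀ {t m u α} f → t ≤ m * f → 2 ^ f * α ≤ u → t ≤ m ·log[ u / α ]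
≤-·log {t} {m} {u} {α} f t≤mf 2^fα≤u = inj₂ (begin
  2 ^ t * α ^ m         ≤⟨ *-monoˡ-≤ (α ^ m) (^-monoʳ-≤ 2 t≤mf) ⟩
  2 ^ (m * f) * α ^ m   ≡⟨ cong (λ e → 2 ^ e * α ^ m) (*-comm m f) ⟩
  2 ^ (f * m) * α ^ m   ≡⟨ cong (_* α ^ m) (^-*-assoc 2 f m) ⟨
  (2 ^ f) ^ m * α ^ m   ≡⟨ ^-distribʳ-* m (2 ^ f) α ⟨
  (2 ^ f * α) ^ m       ≤⟨ ^-monoˡ-≤ m 2^fα≤u ⟩
  u ^ m                 ∎)
  where open ≤-Reasoning

small-factor : ∀ {t} p {x} → x ≤ 10 → t ≤ p * x → t ≤ 10 * p
small-factor p x≤10 t≤ = ≤-trans t≤ (≤-trans (*-monoʳ-≤ p x≤10) (≤-reflexive (*-comm p 10)))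

-- Here e estimates log₂ (u / α) from above with an error of at most 2.
≤-·log-approx : ∀ {t u} a α e → t ≤ a * α * (2 * (2 + e)) →
                (∀ f → e ≡ 2 + suc f → 2 ^ suc f * α ≤ u) →
                t ≤ 10 * (a * α) ·log[ u / α ]
-- For `e ≤ 2` the factor `2 * (2 + e)` is 4, 6 or 8, and the constant side of the maximum absorbs
-- it.
≤-·log-approx a α zero                t≤ _ = inj₁ (small-factor (a * α) {4} (m≤m+n _ _) t≤)
≤-·log-approx a α (suc zero)          t≤ _ = inj₁ (small-factor (a * α) {6} (m≤m+n _ _) t≤)
≤-·log-approx a α (suc (suc zero))    t≤ _ = inj₁ (small-factor (a * α) {8} (m≤m+n _ _) t≤)
-- The origin of 10: `2 * (5 + f) ≤ 10 * suc f`, with equality at `f = 0`.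
≤-·log-approx a α (suc (suc (suc f))) t≤ large = ≤-·log (suc f)
  (≤-trans t≤ (≤-trans (m≤m+n _ (a * α * (8 * f))) (≤-reflexive (regroup (a * α) f)))) (large f refl)
  where
  regroup : ∀ p f → p * (2 * (5 + f)) + p * (8 * f) ≡ 10 * p * suc f
  regroup = solve-∀

visits⇒time : ∀ {t V w u α} a → .{{_ : NonZero u}} .{{_ : NonZero α}} → t ≤ a * V → w ≤ α →
  (∀ D h → u ≤ 2 ^ h → suc V ≤ 2 * 2 ^ D + 2 * (w * (suc h ∸ D))) →
  t ≤ 10 * (a * α) ·log[ u / α ]
visits⇒time {t} {V} {w} {u} {α} a t≤ w≤α bound
  with log₂-bracket α | log₂-bracket u
... | D , 2^D≤α , α<2^1+D | E , 2^E≤u , u<2^1+E = ≤-·log-approx a α e (begin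
  t                                               ≤⟨ t≤ ⟩
  a * V                                           ≤⟨ *-monoʳ-≤ a (<⇒≤ (bound D h (<⇒≤ u<2^1+E))) ⟩
  a * (2 * 2 ^ D + 2 * (w * (suc h ∸ D)))
    ≤⟨ *-monoʳ-≤ a (+-mono-≤ (*-monoʳ-≤ 2 2^D≤α) (*-monoʳ-≤ 2 (*-mono-≤ w≤α 1+h∸D≤1+e))) ⟩
  a * (2 * α + 2 * (α * suc e))                   ≡⟨ regroup a α e ⟩
  a * α * (2 * (2 + e))                           ∎) large
  where
  open ≤-Reasoning
  -- `u < 2 ^ suc E` makes `suc E` an admissible height bound. When `D ≤ h`, the two brackets place
  -- `u / α` strictly between `2 ^ (e - 2)` and `2 ^ e`.
  h = suc E
  e = h ∸ D

  -- An equality when `D ≤ h`. Since `α` can exceed `u`, `D` can exceed `h`, and then both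
  -- subtractions truncate to 0.
  1+h∸D≤1+e : suc h ∸ D ≤ suc e
  1+h∸D≤1+e = m≤n+o⇒m∸n≤o (suc h) D (≤-trans (s≤s (m≤n+m∸n h D)) (≤-reflexive (sym (+-suc D e))))

  regroup : ∀ a α e → a * (2 * α + 2 * (α * suc e)) ≡ a * α * (2 * (2 + e))
  regroup = solve-∀

  large : ∀ f → e ≡ 2 + suc f → 2 ^ suc f * α ≤ u
  -- Both sides are scaled by 4 so that exponents are only added, never subtracted.
  large f e≡ = *-cancelˡ-≤ 4 (begin
    4 * (2 ^ suc f * α)                ≤⟨ *-monoʳ-≤ 4 (*-monoʳ-≤ (2 ^ suc f) (<⇒≤ α<2^1+D)) ⟩
    4 * (2 ^ suc f * (2 * 2 ^ D))      ≡⟨ rearrange (2 ^ suc f) (2 ^ D) ⟩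
    2 * (2 ^ (2 + suc f) * 2 ^ D)      ≡⟨ cong (2 *_) (^-distribˡ-+-* 2 (2 + suc f) D) ⟨
    2 * 2 ^ (2 + suc f + D)            ≡⟨ cong (λ x → 2 * 2 ^ (x + D)) e≡ ⟨
    2 * 2 ^ (e + D)                    ≡⟨ cong (λ x → 2 * 2 ^ x) (m∸n+n≡m D≤h) ⟩
    2 * (2 * 2 ^ E)                    ≡⟨ *-assoc 2 2 (2 ^ E) ⟨
    4 * 2 ^ E                          ≤⟨ *-monoʳ-≤ 4 2^E≤u ⟩
    4 * u                              ∎)
    where
    D≤h : D ≤ h
    D≤h = <⇒≤ (m∸n≢0⇒n<m λ e≡0 → contradiction (trans (sym e≡0) e≡) λ ())
    rearrange : ∀ x y → 4 * (x * (2 * y)) ≡ 2 * (2 * (2 * x) * y)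
    rearrange = solve-∀

-- The initial state at the root.

module Root (S : List (Fin σ)) (W : Tree σ) (R : Vec Range k)
            (waveletTree : IsBalancedWaveletTree S W) (nonempty : NonemptyRangesOf S R) where
  open IsBalancedWaveletTree waveletTree

  X : Fin k → List (Fin σ)
  X r = slice S (lookup R r)

  ∈-leaves : ∀ {c} → c ∈ S → c ∈ leaves W
  ∈-leaves {c} c∈S = subst (c ∈_) (sym leaves-distinct) (∈-filter⁺ (_∈? S) (∈-allFin c) c∈S)

  leaves-unique : Unique (leaves W)
  leaves-unique = subst Unique (sym leaves-distinct) (Unique.filter⁺ (_∈? S) (Unique.allFin⁺ σ))

  represents-root : ∀ r → Represents S W (X r) (lookup R r)
  represents-root r = record
    { lo-positive = proj₁ (nonempty r)
    ; hi-bounded  = ≤-trans (proj₂ (proj₂ (nonempty r))) (≤-reflexive (cong length (sym S-root)))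
    ; contents    = trans (cong (λ S → slice S (lookup R r)) S-root)
        (sym (filter-all (_∈? leaves W) (All.tabulate (∈-leaves ∘ ∈-slice⁻ S (lookup R r)))))
    }
    where
    S-root : subsequence S W ≡ S
    S-root = filter-all (_∈? leaves W) (All.tabulate ∈-leaves)

  -- Yields `α ≥ 1` through `live⇒weight≥1`, so that `log₂-bracket` applies to `α`.
  live-root : Live X W
  live-root r =
    let c , c∈W , c∈X = lo≤hi⇒meets (represents-root r) (proj₁ (proj₂ (nonempty r)))
    in lose c∈W c∈X

  -- The index supplies one range containing the common symbol, which therefore occurs in `S` and
  -- labels a leaf; with no ranges, every symbol of the alphabet would count as common.
  common-reports : Fin k → ReportsIntersection S R (filter (common? X) (leaves W))
  common-reports r = Unique.filter⁺ (common? X) leaves-unique , λ c → mk⇔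
    (proj₂ ∘ ∈-filter⁻ (common? X) {xs = leaves W})
    (λ common → ∈-filter⁺ (common? X) {xs = leaves W} (∈-leaves (∈-slice⁻ S (lookup R r) (common r))) common)

  weight-root : (C : Fin σ → Fin (suc k)) → weight C (leaves W) ≤ zeros C + switches C
  weight-root C = begin
    weight C (leaves W)     ≡⟨ cong (weight C) leaves-distinct ⟩
    weight C (distinct S)   ≤⟨ weight-mono C (filter-⊆ (_∈? S) (allFin σ)) ⟩
    weight C (allFin σ)     ≡⟨ weight-allFin C ⟩
    zeros C + switches C    ∎
    where open ≤-Reasoning

firstIndex : ∀ k .{{_ : NonZero k}} → Fin k
firstIndex (suc k) = zero

lemma6 : (cost : CostModel) →
    ∃[ K ] ((σ k : ℕ) .{{_ : NonZero k}} (S : List (Fin σ)) (W : Tree σ) (R : Vec Range k) (α : ℕ) →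
    IsBalancedWaveletTree S W →
    NonemptyRangesOf S R →
    IsAlternationComplexity S R α →
    ReportsIntersection S R (output (intersect cost W R))
    × time (intersect cost W R) ≤ K * (α * k) ·log[ length (distinct S) / α ])
-- The factor 10 comes from `≤-·log-approx`; `visitCost 1` bounds the charge per visit and per
-- range.
lemma6 cost = 10 * visitCost 1 , λ σ k S W R α waveletTree nonempty (C , certificate , _ , α≡) →
  let open IsBalancedWaveletTree waveletTree
      open Root S W R waveletTree nonempty
      output≡ , time≤ = intersect-correct W R leaves-unique bitmaps represents-root
      weight≤α = subst (weight C (leaves W) ≤_) (sym α≡) (weight-root C)
      1≤α = ≤-trans (live⇒weight≥1 X certificate W live-root) weight≤α
      1≤u = subst (1 ≤_) (cong length leaves-distinct) (leaves-nonempty W)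
  in subst (ReportsIntersection S R) (sym output≡) (common-reports (firstIndex k)) ,
     subst (λ m → time (intersect cost W R) ≤ m ·log[ length (distinct S) / α ])
       (regroup k (visitCost 1) α)
       (visits⇒time {w = weight C (leaves W)} (k * visitCost 1) {{>-nonZero 1≤u}} {{>-nonZero 1≤α}}
         (≤-trans time≤ (*-monoˡ-≤ (visits X W) (visitCost-linear k)))
         weight≤α
         (λ D h u≤2^h → visits-bound X certificate W D h balanced
            (subst (_≤ 2 ^ h) (cong length (sym leaves-distinct)) u≤2^h)))
  where
  open Analysis cost
  regroup : ∀ k c α → 10 * (k * c * α) ≡ 10 * c * (α * k)
  regroup = solve-∀
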